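{- Let $r,s$ be positive integers with $1\le s<r/2$ such that $s,\ r-s,\ r+s,\ 2r-s$ are pairwise coprime, and define $p_4(n)$ by $$\sum_{n=0}^\infty p_4(n)q^n=\frac{1}{(1-q^s)(1-q^{r-s})(1-q^{r+s})(1-q^{2r-s})}.$$ Let $\Delta=s(r-s)(r+s)(2r-s)$. Then for all integers $n\ge 0$, $$p_4(n)=P_3(n)+C_4+Q(n),$$ where $$P_3(n)=\frac{n^3+6n^2r+n\left(21r^2+2rs-2s^2\right)/2}{6\Delta},$$ $C_4$ is a constant depending only on $r$ and $s$, and $Q$ is a periodic function of $n$ with period $\Delta$. -}

module Defs where

open import Data.Bool.Base using (if_then_else_)
open import Data.Fin.Base using (toℕ)
open import Data.Integer.Base as ℤ using (ℤ; +_; 0ℤ; 1ℤ)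
import Data.Integer.Properties as ℤₚ
open import Data.Integer.Tactic.RingSolver using (solve-∀)
open import Data.List.Base using (List; []; _∷_)
open import Data.Nat.Base
  using (ℕ; zero; suc; _+_; _*_; _∸_; _≤_; _<_; _≡ᵇ_; NonZero; >-nonZero)
open import Data.Nat.Properties
  using (m*n≢0; m<n⇒0<n∸m; m≤m+n; ≤-trans; ≤-<-trans; <-≤-trans; m≤n+m)
open import Data.Rational.Base as ℚ using (ℚ)
open import Relation.Binary.PropositionalEquality
  using (_≡_; _≗_; refl; sym; trans; cong; cong₂)

open import Algebra.Properties.Semiring.Sum ℤₚ.+-*-semiring using (sum⁺-syntax)

------------------------------------------------------------------------
-- Formal power series in q over ℤ, as coefficient sequences

Series : Set
Series = ℕ → ℤ

q^_ : ℕ → Series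
(q^ k) n = if k ≡ᵇ n then 1ℤ else 0ℤ

1ˢ : Series
1ˢ = q^ 0

1-q^_ : ℕ → Series
(1-q^ k) n = 1ˢ n ℤ.- (q^ k) n

infixl 7 _*ˢ_ _/ˢ_

_*ˢ_ : Series → Series → Series
(f *ˢ g) n = ∑[ i ≤ n ] (f (toℕ i) ℤ.* g (n ∸ toℕ i))

-- Long division of power series.  It is meant for divisors f with f 0 ≡ 1,
-- for which /ˢ-correct shows that it is the quotient.
_/ˢ_ : Series → Series → Series
(a /ˢ f) zero    = a 0
(a /ˢ f) (suc n) = ((λ m → a (suc m) ℤ.- a 0 ℤ.* f (suc m)) /ˢ f) n

/ˢ-correct : ∀ a f → f 0 ≡ 1ℤ → (a /ˢ f) *ˢ f ≗ a
/ˢ-correct a f f0≡1 zero =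
  trans (ℤₚ.+-identityʳ (a 0 ℤ.* f 0))
        (trans (cong (a 0 ℤ.*_) f0≡1) (ℤₚ.*-identityʳ (a 0)))
/ˢ-correct a f f0≡1 (suc n) =
  trans (cong (ℤ._+_ (a 0 ℤ.* f (suc n)))
              (/ˢ-correct (λ m → a (suc m) ℤ.- a 0 ℤ.* f (suc m)) f f0≡1 n))
        (cancel (a 0 ℤ.* f (suc n)) (a (suc n)))
  where
  cancel : ∀ x y → x ℤ.+ (y ℤ.- x) ≡ y
  cancel = solve-∀

------------------------------------------------------------------------
-- The parts s, r − s, r + s, 2r − s.  Truncated subtraction is the true
-- one as long as s ≤ r.

parts : ℕ → ℕ → List ℕ
parts r s = s ∷ r ∸ s ∷ r + s ∷ 2 * r ∸ s ∷ []

Δ : ℕ → ℕ → ℕ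
Δ r s = s * (r ∸ s) * (r + s) * (2 * r ∸ s)

denominator : ℕ → ℕ → Series
denominator r s = 1-q^ s *ˢ 1-q^ (r ∸ s) *ˢ 1-q^ (r + s) *ˢ 1-q^ (2 * r ∸ s)

p₄ : ℕ → ℕ → Series
p₄ r s = 1ˢ /ˢ denominator r s

module _ {r s : ℕ} (1≤s : 1 ≤ s) (2s<r : 2 * s < r) where

  private
    s<r : s < r
    s<r = ≤-<-trans (m≤m+n s (s + 0)) 2s<r

    0<r-s : 0 < r ∸ s
    0<r-s = m<n⇒0<n∸m s<r

    0<r+s : 0 < r + s
    0<r+s = ≤-trans 1≤s (m≤n+m s r)

    0<2r-s : 0 < 2 * r ∸ s
    0<2r-s = m<n⇒0<n∸m (<-≤-trans s<r (m≤m+n r (r + 0)))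

    const≡1 : ∀ {k} → 0 < k → (1-q^ k) 0 ≡ 1ℤ
    const≡1 {suc k} _ = refl

    *ˢ-const≡1 : ∀ f g → f 0 ≡ 1ℤ → g 0 ≡ 1ℤ → (f *ˢ g) 0 ≡ 1ℤ
    *ˢ-const≡1 f g p q = trans (ℤₚ.+-identityʳ (f 0 ℤ.* g 0)) (cong₂ ℤ._*_ p q)

  Δ≢0 : NonZero (Δ r s)
  Δ≢0 = m*n≢0 (s * (r ∸ s) * (r + s)) (2 * r ∸ s)
    {{m*n≢0 (s * (r ∸ s)) (r + s)
      {{m*n≢0 s (r ∸ s) {{>-nonZero 1≤s}} {{>-nonZero 0<r-s}}}}
      {{>-nonZero 0<r+s}}}}
    {{>-nonZero 0<2r-s}}

  p₄-correct : p₄ r s *ˢ denominator r s ≗ 1ˢ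
  p₄-correct = /ˢ-correct 1ˢ (denominator r s)
    (*ˢ-const≡1 (1-q^ s *ˢ 1-q^ (r ∸ s) *ˢ 1-q^ (r + s)) (1-q^ (2 * r ∸ s))
      (*ˢ-const≡1 (1-q^ s *ˢ 1-q^ (r ∸ s)) (1-q^ (r + s))
        (*ˢ-const≡1 (1-q^ s) (1-q^ (r ∸ s)) (const≡1 1≤s) (const≡1 0<r-s))
        (const≡1 0<r+s))
      (const≡1 0<2r-s))

------------------------------------------------------------------------
-- The polynomial part

fromℤ : ℤ → ℚ
fromℤ i = i ℚ./ 1

P₃ : (r s : ℕ) .{{_ : NonZero (Δ r s)}} → ℕ → ℚ
P₃ r s n =
  (fromℤ (N ℤ.^ 3 ℤ.+ + 6 ℤ.* N ℤ.^ 2 ℤ.* R)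
    ℚ.+ (N ℤ.* (+ 21 ℤ.* R ℤ.^ 2 ℤ.+ + 2 ℤ.* R ℤ.* S ℤ.- + 2 ℤ.* S ℤ.^ 2)) ℚ./ 2)
  ℚ.* (1ℤ ℚ./ (6 * Δ r s)) {{m*n≢0 6 (Δ r s)}}
  where
  N = + n
  R = + r
  S = + s

Periodic : ℕ → (ℕ → ℚ) → Set
Periodic T Q = ∀ n → Q (n + T) ≡ Q n

{-# OPTIONS --safe #-}

-- Let S be the shift of sequences and [k] = 1 + S + ⋯ + S^(k−1), the sum over
-- a window of length k.  For coprime a and b, [a] [b] x = 0 implies [a b] x = 0.
-- Applied to the differences v of the sequence p₄ − P₃, which satisfy
-- [s] [r−s] [r+s] [2r−s] v = 0, this gives [Δ] v = 0; and [Δ] v telescopes to the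
-- difference of p₄ − P₃ at distance Δ.  The hypothesis on v holds because the
-- four windows take both difference sequences to the same binomial coefficient:
-- for p₄, ∏ (1 − q^k) / (1 − q) times the generating function is 1 / (1 − q)⁴;
-- for P₃, a cubic odd about −2r up to a constant, the difference is a quadratic
-- on which windows act in closed form.

module Submission where

open import Defs
open import Data.Integer.Base as ℤ using (ℤ; +_; 0ℤ; 1ℤ; _+_; _-_; _*_; _^_)
import Data.Integer.Properties as ℤ
open import Data.Integer.Tactic.RingSolver using (solve-∀)
open import Data.List.Base using (List; []; _∷_; length; map)
open import Data.List.Relation.Unary.All using (All; []; _∷_)
open import Data.List.Relation.Unary.AllPairs using (AllPairs; []; _∷_)
open import Data.Nat.Base as ℕ using (ℕ; zero; suc; pred; NonZero)
open import Data.Nat.Coprimality using (Coprime; coprime-Bézout; coprime-divisor)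
import Data.Nat.Coprimality as Coprime
open import Data.Nat.Divisibility using (∣-trans; ∣1⇒≡1)
open import Data.Nat.GCD using (module Bézout)
open import Data.Nat.ListAction using (product; sum)
open import Data.Nat.ListAction.Properties using (product≢0)
import Data.Nat.Properties as ℕ
open import Data.Product.Base using (Σ-syntax; _×_; _,_)
open import Data.Rational.Base as ℚ using (ℚ; 0ℚ; toℚᵘ)
import Data.Rational.Properties as ℚ
open import Data.Rational.Unnormalised.Base as ℚᵘ using (mkℚᵘ; *≡*; _≃_)
import Data.Rational.Unnormalised.Properties as ℚᵘ
open import Data.Sum.Base using (inj₁; inj₂)
open import Function.Base using (_∘_)
import Relation.Binary.Reasoning.Setoid as SetoidReasoning
open import Relation.Binary.PropositionalEquality
  using (_≡_; _≗_; refl; sym; trans; cong; cong₂; subst; module ≡-Reasoning)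
open import Relation.Nullary.Negation using (contradiction)

fraction : ∀ p x y d .{{_ : NonZero d}} →
  fromℤ p ℚ.- (fromℤ x ℚ.+ y ℚ./ 2) ℚ.* (1ℤ ℚ./ d)
    ≡ ((+ 2 * + d * p - (+ 2 * x + y)) ℚ./ (2 ℕ.* d)) {{ℕ.m*n≢0 2 d}}
fraction p x y d@(suc k) = ℚ.toℚᵘ-injective (begin
  toℚᵘ (fromℤ p ℚ.- z ℚ.* e)
    ≈⟨ ℚ.toℚᵘ-homo-+ (fromℤ p) (ℚ.- (z ℚ.* e)) ⟩
  toℚᵘ (fromℤ p) ℚᵘ.+ toℚᵘ (ℚ.- (z ℚ.* e))
    ≈⟨ ℚᵘ.+-cong (ℚ.toℚᵘ-fromℚᵘ (mkℚᵘ p 0))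
         (ℚᵘ.≃-trans (ℚ.toℚᵘ-homo‿- (z ℚ.* e)) (ℚᵘ.-‿cong ze)) ⟩
  mkℚᵘ p 0 ℚᵘ.- (mkℚᵘ x 0 ℚᵘ.+ mkℚᵘ y 1) ℚᵘ.* mkℚᵘ 1ℤ k
    ≈⟨ *≡* (trans (expand p x y (+ (2 ℕ.* d)))
         (cong₂ (λ a b → (a * p - (+ 2 * x + y)) * b)
           (ℤ.pos-* 2 d) (cong +_ (sym (ℕ.*-identityˡ (2 ℕ.* d)))))) ⟩
  mkℚᵘ v (pred (2 ℕ.* d))
    ≈⟨ ℚ.toℚᵘ-fromℚᵘ (mkℚᵘ v (pred (2 ℕ.* d))) ⟨
  toℚᵘ (v ℚ./ (2 ℕ.* d)) ∎)
  where
  open SetoidReasoning ℚᵘ.≃-setoid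
  z = fromℤ x ℚ.+ y ℚ./ 2
  e = 1ℤ ℚ./ d
  v = + 2 * + d * p - (+ 2 * x + y)

  ze : toℚᵘ (z ℚ.* e) ≃ (mkℚᵘ x 0 ℚᵘ.+ mkℚᵘ y 1) ℚᵘ.* mkℚᵘ 1ℤ k
  ze = ℚᵘ.≃-trans (ℚ.toℚᵘ-homo-* z e)
    (ℚᵘ.*-cong
      (ℚᵘ.≃-trans (ℚ.toℚᵘ-homo-+ (fromℤ x) (y ℚ./ 2))
        (ℚᵘ.+-cong (ℚ.toℚᵘ-fromℚᵘ (mkℚᵘ x 0)) (ℚ.toℚᵘ-fromℚᵘ (mkℚᵘ y 1))))
      (ℚ.toℚᵘ-fromℚᵘ (mkℚᵘ 1ℤ k)))

  expand : ∀ p x y e →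
    (p * e + ℤ.- ((x * + 2 + y * 1ℤ) * 1ℤ) * 1ℤ) * e ≡ (e * p - (+ 2 * x + y)) * e
  expand = solve-∀

open ≡-Reasoning

-- Windowed sums

diff : Series → Series
diff x n = x (suc n) - x n

window : ℕ → Series → Series
window zero    x n = 0ℤ
window (suc k) x n = x n + window k x (suc n)

windows : List ℕ → Series → Series
windows []       x = x
windows (k ∷ ks) x = windows ks (window k x)

private
  regroup-+ : ∀ a b c d → (a + b) + (c + d) ≡ (a + c) + (b + d)
  regroup-+ = solve-∀

  regroup-- : ∀ a b c d → (a - b) + (c - d) ≡ (a + c) - (b + d)
  regroup-- = solve-∀

  +-congˡ : ∀ i {j k} → j ≡ k → i + j ≡ i + k
  +-congˡ i = cong (λ j → i + j)

  a-b≡0⇒ : ∀ {a b} → a - b ≡ 0ℤ → a ≡ b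
  a-b≡0⇒ = ℤ.i-j≡0⇒i≡j _ _

window-cong : ∀ k {x y} → x ≗ y → window k x ≗ window k y
window-cong zero    eq n = refl
window-cong (suc k) eq n = cong₂ _+_ (eq n) (window-cong k eq (suc n))

window-shift : ∀ k x m n → window k (λ i → x (i ℕ.+ m)) n ≡ window k x (n ℕ.+ m)
window-shift zero    x m n = refl
window-shift (suc k) x m n = +-congˡ (x (n ℕ.+ m)) (window-shift k x m (suc n))

window-linear : ∀ k c x y n →
  window k (λ i → c * x i - y i) n ≡ c * window k x n - window k y n
window-linear zero    c x y n = sym (trans (ℤ.+-identityʳ _) (ℤ.*-zeroʳ c))
window-linear (suc k) c x y n =
  trans (+-congˡ (c * x n - y n) (window-linear k c x y (suc n)))
    (regroup c (x n) (y n) (window k x (suc n)) (window k y (suc n)))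
  where
  regroup : ∀ c a b d e → (c * a - b) + (c * d - e) ≡ c * (a + d) - (b + e)
  regroup = solve-∀

window-distrib-+ : ∀ k x y n →
  window k (λ i → x i + y i) n ≡ window k x n + window k y n
window-distrib-+ zero    x y n = refl
window-distrib-+ (suc k) x y n =
  trans (+-congˡ (x n + y n) (window-distrib-+ k x y (suc n)))
    (regroup-+ (x n) (y n) (window k x (suc n)) (window k y (suc n)))

window-zero : ∀ k {x} → (∀ n → x n ≡ 0ℤ) → ∀ n → window k x n ≡ 0ℤ
window-zero zero    x≡0 n = refl
window-zero (suc k) x≡0 n = cong₂ _+_ (x≡0 n) (window-zero k x≡0 (suc n))

window-diff : ∀ k x → window k (diff x) ≗ diff (window k x)
window-diff zero    x n = refl
window-diff (suc k) x n =
  trans (+-congˡ (diff x n) (window-diff k x (suc n)))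
    (regroup-- (x (suc n)) (x n) (window k x (suc (suc n))) (window k x (suc n)))

window-telescope : ∀ k x n → window k (diff x) n ≡ x (k ℕ.+ n) - x n
window-telescope zero    x n = sym (ℤ.+-inverseʳ (x n))
window-telescope (suc k) x n = begin
  (x (suc n) - x n) + window k (diff x) (suc n)
    ≡⟨ +-congˡ (diff x n) (window-telescope k x (suc n)) ⟩
  (x (suc n) - x n) + (x (k ℕ.+ suc n) - x (suc n))
    ≡⟨ cancel (x (suc n)) (x n) (x (k ℕ.+ suc n)) ⟩
  x (k ℕ.+ suc n) - x n
    ≡⟨ cong (λ i → x i - x n) (ℕ.+-suc k n) ⟩
  x (suc k ℕ.+ n) - x n ∎
  where
  cancel : ∀ a b c → (a - b) + (c - a) ≡ c - b
  cancel = solve-∀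

window-+ : ∀ j k x n → window (j ℕ.+ k) x n ≡ window j x n + window k x (j ℕ.+ n)
window-+ zero    k x n = sym (ℤ.+-identityˡ _)
window-+ (suc j) k x n = begin
  x n + window (j ℕ.+ k) x (suc n)
    ≡⟨ +-congˡ (x n) (window-+ j k x (suc n)) ⟩
  x n + (window j x (suc n) + window k x (j ℕ.+ suc n))
    ≡⟨ ℤ.+-assoc (x n) _ _ ⟨
  x n + window j x (suc n) + window k x (j ℕ.+ suc n)
    ≡⟨ cong (λ i → x n + window j x (suc n) + window k x i) (ℕ.+-suc j n) ⟩
  x n + window j x (suc n) + window k x (suc j ℕ.+ n) ∎

windows-cong : ∀ ks {x y} → x ≗ y → windows ks x ≗ windows ks y
windows-cong []       eq = eq
windows-cong (k ∷ ks) eq = windows-cong ks (window-cong k eq)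

windows-shift : ∀ ks x m n → windows ks (λ i → x (i ℕ.+ m)) n ≡ windows ks x (n ℕ.+ m)
windows-shift []       x m n = refl
windows-shift (k ∷ ks) x m n =
  trans (windows-cong ks (window-shift k x m) n) (windows-shift ks (window k x) m n)

windows-linear : ∀ ks c x y n →
  windows ks (λ i → c * x i - y i) n ≡ c * windows ks x n - windows ks y n
windows-linear []       c x y n = refl
windows-linear (k ∷ ks) c x y n =
  trans (windows-cong ks (window-linear k c x y) n) (windows-linear ks c _ _ n)

windows-diff : ∀ ks x → windows ks (diff x) ≗ diff (windows ks x)
windows-diff []       x n = refl
windows-diff (k ∷ ks) x n =
  trans (windows-cong ks (window-diff k x) n) (windows-diff ks (window k x) n)

-- Periodicity and coprime periods

HasPeriod : ℕ → Series → Set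
HasPeriod k x = ∀ n → x (k ℕ.+ n) ≡ x n

multiple-period : ∀ {k x} j → HasPeriod k x → HasPeriod (j ℕ.* k) x
multiple-period         zero    per n = refl
multiple-period {k} {x} (suc j) per n =
  trans (cong x (ℕ.+-assoc k (j ℕ.* k) n)) (trans (per _) (multiple-period j per n))

coprime-periods⇒constant : ∀ {a b x} → Coprime a b →
  HasPeriod a x → HasPeriod b x → HasPeriod 1 x
coprime-periods⇒constant {x = x} cop per-a per-b n with coprime-Bézout cop
... | Bézout.+- i j eq = begin
  x (1 ℕ.+ n)                ≡⟨ multiple-period j per-b (1 ℕ.+ n) ⟨
  x (j ℕ.* _ ℕ.+ (1 ℕ.+ n))  ≡⟨ cong x (ℕ.+-suc _ n) ⟩
  x ((1 ℕ.+ j ℕ.* _) ℕ.+ n)  ≡⟨ cong (λ m → x (m ℕ.+ n)) eq ⟩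
  x (i ℕ.* _ ℕ.+ n)          ≡⟨ multiple-period i per-a n ⟩
  x n                        ∎
... | Bézout.-+ i j eq = begin
  x (1 ℕ.+ n)                ≡⟨ multiple-period i per-a (1 ℕ.+ n) ⟨
  x (i ℕ.* _ ℕ.+ (1 ℕ.+ n))  ≡⟨ cong x (ℕ.+-suc _ n) ⟩
  x ((1 ℕ.+ i ℕ.* _) ℕ.+ n)  ≡⟨ cong (λ m → x (m ℕ.+ n)) eq ⟩
  x (j ℕ.* _ ℕ.+ n)          ≡⟨ multiple-period j per-b n ⟩
  x n                        ∎

window-constant : ∀ k {x} → HasPeriod 1 x → ∀ n → window k x n ≡ + k * x n
window-constant zero        per n = refl
window-constant (suc k) {x} per n = begin
  x n + window k x (suc n)  ≡⟨ +-congˡ (x n) (window-constant k per (suc n)) ⟩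
  x n + + k * x (suc n)     ≡⟨ cong (λ z → x n + + k * z) (per n) ⟩
  x n + + k * x n           ≡⟨ ℤ.suc-* (+ k) (x n) ⟨
  + suc k * x n             ∎

module _ {b : ℕ} {x : Series} where

  private
    step : ∀ j n → window (b ℕ.+ j ℕ.* b) x n ≡ window b x n + window (j ℕ.* b) x (b ℕ.+ n)
    step j n = window-+ b (j ℕ.* b) x n

  window-*-period : ∀ {a} j → HasPeriod a (window b x) → HasPeriod a (window (j ℕ.* b) x)
  window-*-period     zero    per n = refl
  window-*-period {a} (suc j) per n = begin
    window (b ℕ.+ j ℕ.* b) x (a ℕ.+ n)
      ≡⟨ step j (a ℕ.+ n) ⟩
    window b x (a ℕ.+ n) + window (j ℕ.* b) x (b ℕ.+ (a ℕ.+ n))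
      ≡⟨ cong₂ _+_ (per n) (cong (window (j ℕ.* b) x) swap) ⟩
    window b x n + window (j ℕ.* b) x (a ℕ.+ (b ℕ.+ n))
      ≡⟨ +-congˡ (window b x n) (window-*-period j per (b ℕ.+ n)) ⟩
    window b x n + window (j ℕ.* b) x (b ℕ.+ n)
      ≡⟨ step j n ⟨
    window (b ℕ.+ j ℕ.* b) x n ∎
    where
    swap : b ℕ.+ (a ℕ.+ n) ≡ a ℕ.+ (b ℕ.+ n)
    swap = trans (sym (ℕ.+-assoc b a n))
                 (trans (cong (ℕ._+ n) (ℕ.+-comm b a)) (ℕ.+-assoc a b n))

  window-*-zero : ∀ a j → (∀ n → window a (window b x) n ≡ 0ℤ) →
    ∀ n → window a (window (j ℕ.* b) x) n ≡ 0ℤ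
  window-*-zero a zero    z n = window-zero a (λ _ → refl) n
  window-*-zero a (suc j) z n = begin
    window a (window (b ℕ.+ j ℕ.* b) x) n
      ≡⟨ window-cong a (λ i → trans (step j i)
           (cong (λ m → window b x i + window (j ℕ.* b) x m) (ℕ.+-comm b i))) n ⟩
    window a (λ i → window b x i + window (j ℕ.* b) x (i ℕ.+ b)) n
      ≡⟨ window-distrib-+ a (window b x) _ n ⟩
    window a (window b x) n + window a (λ i → window (j ℕ.* b) x (i ℕ.+ b)) n
      ≡⟨ cong₂ _+_ (z n) (window-shift a _ b n) ⟩
    0ℤ + window a (window (j ℕ.* b) x) (n ℕ.+ b)
      ≡⟨ +-congˡ 0ℤ (window-*-zero a j z (n ℕ.+ b)) ⟩
    0ℤ ∎

-- The window of length a * b has both a and b as periods, so it is constant,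
-- and a times that constant is zero.
window-coprime-* : ∀ {a b x} .{{_ : NonZero a}} → Coprime a b →
  (∀ n → window a (window b x) n ≡ 0ℤ) → ∀ n → window (a ℕ.* b) x n ≡ 0ℤ
window-coprime-* {a} {b} {x} cop z n
  with ℤ.i*j≡0⇒i≡0∨j≡0 (+ a)
         (trans (sym (window-constant a (coprime-periods⇒constant cop per-a per-b) n))
                (window-*-zero a a z n))
  where
  zero-sum⇒period : HasPeriod a (window b x)
  zero-sum⇒period m = a-b≡0⇒ (begin
    window b x (a ℕ.+ m) - window b x m  ≡⟨ window-telescope a (window b x) m ⟨
    window a (diff (window b x)) m       ≡⟨ window-diff a (window b x) m ⟩
    window a (window b x) (suc m) - window a (window b x) m
                                         ≡⟨ cong₂ _-_ (z (suc m)) (z m) ⟩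
    0ℤ                                   ∎)

  per-a : HasPeriod a (window (a ℕ.* b) x)
  per-a = window-*-period a zero-sum⇒period

  per-b : HasPeriod b (window (a ℕ.* b) x)
  per-b m = a-b≡0⇒ (begin
    w (b ℕ.+ m) - w m
      ≡⟨ rotate (window b x m) (w (b ℕ.+ m)) (w m) ⟩
    (window b x m + w (b ℕ.+ m)) - (w m + window b x m)
      ≡⟨ cong₂ _-_ (sym (window-+ b (a ℕ.* b) x m))
           (+-congˡ (w m) (sym (ab-period m))) ⟩
    window (b ℕ.+ a ℕ.* b) x m - (w m + window b x (a ℕ.* b ℕ.+ m))
      ≡⟨ cong₂ _-_ (cong (λ k → window k x m) (ℕ.+-comm b (a ℕ.* b)))
           (sym (window-+ (a ℕ.* b) b x m)) ⟩
    window (a ℕ.* b ℕ.+ b) x m - window (a ℕ.* b ℕ.+ b) x m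
      ≡⟨ ℤ.+-inverseʳ (window (a ℕ.* b ℕ.+ b) x m) ⟩
    0ℤ ∎)
    where
    w = window (a ℕ.* b) x

    ab-period : HasPeriod (a ℕ.* b) (window b x)
    ab-period = subst (λ c → HasPeriod c (window b x)) (ℕ.*-comm b a)
                      (multiple-period b zero-sum⇒period)

    rotate : ∀ y u v → u - v ≡ (y + u) - (v + y)
    rotate = solve-∀
... | inj₁ a≡0 = contradiction (ℤ.+-injective a≡0) (ℕ.≢-nonZero⁻¹ a)
... | inj₂ eq  = eq

coprime-product : ∀ {k ks} → All (Coprime k) ks → Coprime k (product ks)
coprime-product []           (_ , d∣1)     = ∣1⇒≡1 d∣1
coprime-product (cop ∷ cops) (d∣k , d∣prod) =
  coprime-product cops
    (d∣k , coprime-divisor (λ (e∣d , e∣l) → cop (∣-trans e∣d d∣k , e∣l)) d∣prod)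

windows-product : ∀ {ks x} → All NonZero ks → AllPairs Coprime ks →
  (∀ n → windows ks x n ≡ 0ℤ) → ∀ n → window (product ks) x n ≡ 0ℤ
windows-product         []         []           z n = trans (ℤ.+-identityʳ _) (z n)
windows-product {k ∷ ks} {x} (nz ∷ nzs) (cop ∷ cops) z n =
  trans (cong (λ m → window m x n) (ℕ.*-comm k (product ks)))
    (window-coprime-* {{product≢0 nzs}} (Coprime.sym (coprime-product cop))
      (windows-product nzs cops z) n)

-- Power series

q·_ : Series → Series
(q· x) zero    = 0ℤ
(q· x) (suc n) = x n

delay : ℕ → Series → Series
delay zero    x = x
delay (suc k) x = q· delay k x

backdiff : ℕ → Series → Series
backdiff k x n = x n - delay k x n

backdiffs : List ℕ → Series → Series
backdiffs []       x = x
backdiffs (k ∷ ks) x = backdiffs ks (backdiff k x)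

q·-cong : ∀ {x y} → x ≗ y → q· x ≗ q· y
q·-cong eq zero    = refl
q·-cong eq (suc n) = eq n

delay-cong : ∀ k {x y} → x ≗ y → delay k x ≗ delay k y
delay-cong zero    eq = eq
delay-cong (suc k) eq = q·-cong (delay-cong k eq)

delay-+ : ∀ k x n → delay k x (k ℕ.+ n) ≡ x n
delay-+ zero    x n = refl
delay-+ (suc k) x n = delay-+ k x n

delay-early : ∀ k x → delay (suc k) x k ≡ 0ℤ
delay-early zero    x = refl
delay-early (suc k) x = delay-early k x

backdiff-cong : ∀ k {x y} → x ≗ y → backdiff k x ≗ backdiff k y
backdiff-cong k eq n = cong₂ _-_ (eq n) (delay-cong k eq n)

backdiffs-cong : ∀ ks {x y} → x ≗ y → backdiffs ks x ≗ backdiffs ks y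
backdiffs-cong []       eq = eq
backdiffs-cong (k ∷ ks) eq = backdiffs-cong ks (backdiff-cong k eq)

*ˢ-congʳ : ∀ x {y z} → y ≗ z → x *ˢ y ≗ x *ˢ z
*ˢ-congʳ x eq zero    = cong (λ a → x 0 * a + 0ℤ) (eq 0)
*ˢ-congʳ x eq (suc n) =
  cong₂ (λ a b → x 0 * a + b) (eq (suc n)) (*ˢ-congʳ (x ∘ suc) eq n)

*ˢ-distribˡ-- : ∀ x y z n → (x *ˢ (λ i → y i - z i)) n ≡ (x *ˢ y) n - (x *ˢ z) n
*ˢ-distribˡ-- x y z zero    = regroup (x 0) (y 0) (z 0)
  where
  regroup : ∀ a b c → a * (b - c) + 0ℤ ≡ (a * b + 0ℤ) - (a * c + 0ℤ)
  regroup = solve-∀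
*ˢ-distribˡ-- x y z (suc n) =
  trans (cong (λ b → x 0 * (y (suc n) - z (suc n)) + b) (*ˢ-distribˡ-- (x ∘ suc) y z n))
        (regroup (x 0) (y (suc n)) (z (suc n)) ((x ∘ suc *ˢ y) n) ((x ∘ suc *ˢ z) n))
  where
  regroup : ∀ a b c d e → a * (b - c) + (d - e) ≡ (a * b + d) - (a * c + e)
  regroup = solve-∀

*ˢ-q· : ∀ x y → x *ˢ (q· y) ≗ q· (x *ˢ y)
*ˢ-q· x y zero          = trans (ℤ.+-identityʳ _) (ℤ.*-zeroʳ (x 0))
*ˢ-q· x y (suc zero)    =
  cong (λ a → x 0 * y 0 + a) (trans (ℤ.+-identityʳ _) (ℤ.*-zeroʳ (x 1)))
*ˢ-q· x y (suc (suc n)) = cong (λ a → x 0 * y (suc n) + a) (*ˢ-q· (x ∘ suc) y (suc n))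

*ˢ-delay : ∀ k x y → x *ˢ delay k y ≗ delay k (x *ˢ y)
*ˢ-delay zero    x y n = refl
*ˢ-delay (suc k) x y n = trans (*ˢ-q· x (delay k y) n) (q·-cong (*ˢ-delay k x y) n)

*ˢ-identityʳ : ∀ x → x *ˢ 1ˢ ≗ x
*ˢ-identityʳ x zero    = trans (ℤ.+-identityʳ _) (ℤ.*-identityʳ (x 0))
*ˢ-identityʳ x (suc n) =
  trans (cong₂ _+_ (ℤ.*-zeroʳ (x 0)) (*ˢ-identityʳ (x ∘ suc) n)) (ℤ.+-identityˡ _)

q^≗delay : ∀ k → q^ k ≗ delay k 1ˢ
q^≗delay zero    n       = refl
q^≗delay (suc k) zero    = refl
q^≗delay (suc k) (suc n) = q^≗delay k n

*ˢ-1-q^ : ∀ k x → x *ˢ 1-q^ k ≗ backdiff k x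
*ˢ-1-q^ k x n = begin
  (x *ˢ 1-q^ k) n
    ≡⟨ *ˢ-distribˡ-- x 1ˢ (q^ k) n ⟩
  (x *ˢ 1ˢ) n - (x *ˢ q^ k) n
    ≡⟨ cong₂ _-_ (*ˢ-identityʳ x n) (trans (*ˢ-congʳ x (q^≗delay k) n)
         (trans (*ˢ-delay k x 1ˢ n) (delay-cong k (*ˢ-identityʳ x) n))) ⟩
  backdiff k x n ∎

*ˢ-backdiff : ∀ k x y → x *ˢ backdiff k y ≗ backdiff k (x *ˢ y)
*ˢ-backdiff k x y n =
  trans (*ˢ-distribˡ-- x y (delay k y) n) (cong ((x *ˢ y) n -_) (*ˢ-delay k x y n))

*ˢ-assoc-1-q^ : ∀ k x y → x *ˢ (y *ˢ 1-q^ k) ≗ backdiff k (x *ˢ y)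
*ˢ-assoc-1-q^ k x y n = trans (*ˢ-congʳ x (*ˢ-1-q^ k y) n) (*ˢ-backdiff k x y n)

*ˢ-denominator : ∀ r s x → x *ˢ denominator r s ≗ backdiffs (parts r s) x
*ˢ-denominator r s x n =
  trans (*ˢ-assoc-1-q^ (2 ℕ.* r ℕ.∸ s) x _ n)
    (backdiff-cong (2 ℕ.* r ℕ.∸ s) (λ n → trans (*ˢ-assoc-1-q^ (r ℕ.+ s) x _ n)
      (backdiff-cong (r ℕ.+ s) (λ n → trans (*ˢ-assoc-1-q^ (r ℕ.∸ s) x _ n)
        (backdiff-cong (r ℕ.∸ s) (*ˢ-1-q^ s x) n)) n)) n)

partialSums : Series → Series
partialSums x zero    = x 0
partialSums x (suc n) = partialSums x n + x (suc n)

partialSums^ : ℕ → Series → Series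
partialSums^ zero    x = x
partialSums^ (suc l) x = partialSums^ l (partialSums x)

partialSums-cong : ∀ {x y} → x ≗ y → partialSums x ≗ partialSums y
partialSums-cong eq zero    = eq 0
partialSums-cong eq (suc n) = cong₂ _+_ (partialSums-cong eq n) (eq (suc n))

partialSums^-cong : ∀ l {x y} → x ≗ y → partialSums^ l x ≗ partialSums^ l y
partialSums^-cong zero    eq = eq
partialSums^-cong (suc l) eq = partialSums^-cong l (partialSums-cong eq)

partialSums-q· : ∀ x → partialSums (q· x) ≗ q· partialSums x
partialSums-q· x zero          = refl
partialSums-q· x (suc zero)    = ℤ.+-identityˡ (x 0)
partialSums-q· x (suc (suc n)) = cong (λ a → a + x (suc n)) (partialSums-q· x (suc n))

partialSums-delay : ∀ k x → partialSums (delay k x) ≗ delay k (partialSums x)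
partialSums-delay zero    x n = refl
partialSums-delay (suc k) x n =
  trans (partialSums-q· (delay k x) n) (q·-cong (partialSums-delay k x) n)

partialSums-- : ∀ x y n →
  partialSums (λ i → x i - y i) n ≡ partialSums x n - partialSums y n
partialSums-- x y zero    = refl
partialSums-- x y (suc n) =
  trans (cong (λ a → a + (x (suc n) - y (suc n))) (partialSums-- x y n))
        (regroup-- (partialSums x n) (partialSums y n) (x (suc n)) (y (suc n)))

partialSums-backdiff : ∀ k x → partialSums (backdiff k x) ≗ backdiff k (partialSums x)
partialSums-backdiff k x n =
  trans (partialSums-- x (delay k x) n)
        (cong (partialSums x n -_) (partialSums-delay k x n))

partialSums-backdiffs : ∀ ks x →
  partialSums (backdiffs ks x) ≗ backdiffs ks (partialSums x)
partialSums-backdiffs []       x n = refl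
partialSums-backdiffs (k ∷ ks) x n =
  trans (partialSums-backdiffs ks (backdiff k x) n)
        (backdiffs-cong ks (partialSums-backdiff k x) n)

partialSums-+ : ∀ k x n →
  partialSums x (k ℕ.+ n) ≡ partialSums x n + window k x (suc n)
partialSums-+ zero    x n = sym (ℤ.+-identityʳ _)
partialSums-+ (suc k) x n = begin
  partialSums x (suc k ℕ.+ n)
    ≡⟨ cong (partialSums x) (ℕ.+-suc k n) ⟨
  partialSums x (k ℕ.+ suc n)
    ≡⟨ partialSums-+ k x (suc n) ⟩
  partialSums x n + x (suc n) + window k x (suc (suc n))
    ≡⟨ ℤ.+-assoc (partialSums x n) (x (suc n)) _ ⟩
  partialSums x n + window (suc k) x (suc n) ∎

window-initial : ∀ k x → window (suc k) x 0 ≡ partialSums x k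
window-initial k x =
  trans (sym (partialSums-+ k x 0)) (cong (partialSums x) (ℕ.+-identityʳ k))

window≡partialSums-backdiff : ∀ k .{{_ : NonZero k}} x n →
  window k x n ≡ partialSums (backdiff k x) (n ℕ.+ pred k)
window≡partialSums-backdiff (suc k) x zero = begin
  window (suc k) x 0
    ≡⟨ window-initial k x ⟩
  partialSums x k
    ≡⟨ ℤ.+-identityʳ _ ⟨
  partialSums x k - 0ℤ
    ≡⟨ cong (partialSums x k -_) (delay-early k (partialSums x)) ⟨
  backdiff (suc k) (partialSums x) k
    ≡⟨ partialSums-backdiff (suc k) x k ⟨
  partialSums (backdiff (suc k) x) k ∎
window≡partialSums-backdiff (suc k) x (suc n) = begin
  window (suc k) x (suc n)
    ≡⟨ cancel (partialSums x n) _ ⟨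
  partialSums x n + window (suc k) x (suc n) - partialSums x n
    ≡⟨ cong₂ _-_ (partialSums-+ (suc k) x n) (delay-+ k (partialSums x) n) ⟨
  backdiff (suc k) (partialSums x) (suc k ℕ.+ n)
    ≡⟨ partialSums-backdiff (suc k) x (suc k ℕ.+ n) ⟨
  partialSums (backdiff (suc k) x) (suc k ℕ.+ n)
    ≡⟨ cong (partialSums (backdiff (suc k) x) ∘ suc) (ℕ.+-comm k n) ⟩
  partialSums (backdiff (suc k) x) (suc n ℕ.+ k) ∎
  where
  cancel : ∀ a b → a + b - a ≡ b
  cancel = solve-∀

windows≡partialSums-backdiffs : ∀ {ks} → All NonZero ks → ∀ x n →
  windows ks x n ≡ partialSums^ (length ks) (backdiffs ks x) (n ℕ.+ sum (map pred ks))
windows≡partialSums-backdiffs []                x n =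
  cong x (sym (ℕ.+-identityʳ n))
windows≡partialSums-backdiffs {k ∷ ks} (nz ∷ nzs) x n = begin
  windows ks (window k x) n
    ≡⟨ windows-cong ks (window≡partialSums-backdiff k {{nz}} x) n ⟩
  windows ks (λ i → y (i ℕ.+ pred k)) n
    ≡⟨ windows-shift ks y (pred k) n ⟩
  windows ks y (n ℕ.+ pred k)
    ≡⟨ windows≡partialSums-backdiffs nzs y (n ℕ.+ pred k) ⟩
  partialSums^ (length ks) (backdiffs ks y) (n ℕ.+ pred k ℕ.+ sum (map pred ks))
    ≡⟨ partialSums^-cong (length ks) (partialSums-backdiffs ks (backdiff k x)) _ ⟨
  partialSums^ (length ks) (partialSums (backdiffs ks (backdiff k x)))
    (n ℕ.+ pred k ℕ.+ sum (map pred ks))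
    ≡⟨ cong (partialSums^ (length ks) (partialSums (backdiffs ks (backdiff k x))))
         (ℕ.+-assoc n (pred k) _) ⟩
  partialSums^ (length (k ∷ ks)) (backdiffs (k ∷ ks) x) (n ℕ.+ sum (map pred (k ∷ ks))) ∎
  where
  y = partialSums (backdiff k x)

triangular : ∀ n → + 2 * partialSums^ 3 1ˢ n ≡ (1ℤ + + n) * (+ 2 + + n)
triangular = P³
  where
  P¹ : ∀ n → partialSums^ 1 1ˢ n ≡ 1ℤ
  P¹ zero    = refl
  P¹ (suc n) = trans (ℤ.+-identityʳ _) (P¹ n)

  P² : ∀ n → partialSums^ 2 1ˢ n ≡ 1ℤ + + n
  P² zero    = refl
  P² (suc n) = trans (cong₂ _+_ (P² n) (P¹ (suc n))) (ℤ.+-comm (1ℤ + + n) 1ℤ)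

  P³ : ∀ n → + 2 * partialSums^ 3 1ˢ n ≡ (1ℤ + + n) * (+ 2 + + n)
  P³ zero    = refl
  P³ (suc n) = begin
    + 2 * (partialSums^ 3 1ˢ n + partialSums^ 2 1ˢ (suc n))
      ≡⟨ ℤ.*-distribˡ-+ (+ 2) (partialSums^ 3 1ˢ n) _ ⟩
    + 2 * partialSums^ 3 1ˢ n + + 2 * partialSums^ 2 1ˢ (suc n)
      ≡⟨ cong₂ (λ a b → a + + 2 * b) (P³ n) (P² (suc n)) ⟩
    (1ℤ + + n) * (+ 2 + + n) + + 2 * (1ℤ + (1ℤ + + n))
      ≡⟨ expand (+ n) ⟩
    (1ℤ + (1ℤ + + n)) * (+ 2 + (1ℤ + + n)) ∎
    where
    expand : ∀ m →
      (1ℤ + m) * (+ 2 + m) + + 2 * (1ℤ + (1ℤ + m)) ≡ (1ℤ + (1ℤ + m)) * (+ 2 + (1ℤ + m))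
    expand = solve-∀

-- Quadratic sequences

-- In the variable 2 n + c a window of length k only moves the centre c by k − 1,
-- and the factor 3 keeps the constant terms integral.
quadratic : ℤ → ℤ → ℤ → Series
quadratic A B c n = + 3 * A * ((+ 2 * + n + c) * (+ 2 * + n + c)) + B

offset : List ℕ → ℤ
offset []       = 0ℤ
offset (k ∷ ks) = (+ k - 1ℤ) + offset ks

excess : List ℕ → ℤ
excess []       = 0ℤ
excess (k ∷ ks) = (+ k * + k - 1ℤ) + excess ks

window-quadratic : ∀ k A B c →
  window k (quadratic A B c)
    ≗ quadratic (+ k * A) (+ k * (B + A * (+ k * + k - 1ℤ))) (c + (+ k - 1ℤ))
window-quadratic zero    A B c n = expand A B c (+ n)
  where
  expand : ∀ A B c n → 0ℤ
    ≡ + 3 * (0ℤ * A) * ((+ 2 * n + (c + (0ℤ - 1ℤ))) * (+ 2 * n + (c + (0ℤ - 1ℤ))))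
        + 0ℤ * (B + A * (0ℤ * 0ℤ - 1ℤ))
  expand = solve-∀
window-quadratic (suc k) A B c n =
  trans (cong (λ z → quadratic A B c n + z) (window-quadratic k A B c (suc n)))
        (expand A B c (+ n) (+ k))
  where
  expand : ∀ A B c n k →
    + 3 * A * ((+ 2 * n + c) * (+ 2 * n + c)) + B
      + (+ 3 * (k * A) * ((+ 2 * (1ℤ + n) + (c + (k - 1ℤ)))
                            * (+ 2 * (1ℤ + n) + (c + (k - 1ℤ))))
          + k * (B + A * (k * k - 1ℤ)))
      ≡ + 3 * ((1ℤ + k) * A) * ((+ 2 * n + (c + ((1ℤ + k) - 1ℤ)))
                                  * (+ 2 * n + (c + ((1ℤ + k) - 1ℤ))))
          + (1ℤ + k) * (B + A * ((1ℤ + k) * (1ℤ + k) - 1ℤ))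
  expand = solve-∀

windows-quadratic : ∀ ks A B c n →
  windows ks (quadratic A B c) n
    ≡ + product ks * (quadratic A B (c + offset ks) n + A * excess ks)
windows-quadratic []       A B c n = expand A B c (+ n)
  where
  expand : ∀ A B c n → + 3 * A * ((+ 2 * n + c) * (+ 2 * n + c)) + B
     ≡ 1ℤ * (+ 3 * A * ((+ 2 * n + (c + 0ℤ)) * (+ 2 * n + (c + 0ℤ))) + B + A * 0ℤ)
  expand = solve-∀
windows-quadratic (k ∷ ks) A B c n = begin
  windows ks (window k (quadratic A B c)) n
    ≡⟨ windows-cong ks (window-quadratic k A B c) n ⟩
  windows ks (quadratic (+ k * A) (+ k * (B + A * (+ k * + k - 1ℤ))) (c + (+ k - 1ℤ))) n
    ≡⟨ windows-quadratic ks (+ k * A) (+ k * (B + A * (+ k * + k - 1ℤ)))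
         (c + (+ k - 1ℤ)) n ⟩
  + product ks * (quadratic (+ k * A) (+ k * (B + A * (+ k * + k - 1ℤ)))
                    (c + (+ k - 1ℤ) + offset ks) n + + k * A * excess ks)
    ≡⟨ expand A B c (+ n) (+ k) (+ product ks) (offset ks) (excess ks) ⟩
  + k * + product ks * rhs
    ≡⟨ cong (_* rhs) (ℤ.pos-* k (product ks)) ⟨
  + product (k ∷ ks) * rhs ∎
  where
  rhs = quadratic A B (c + offset (k ∷ ks)) n + A * excess (k ∷ ks)

  expand : ∀ A B c n k p o e →
    p * (+ 3 * (k * A) * ((+ 2 * n + (c + (k - 1ℤ) + o)) * (+ 2 * n + (c + (k - 1ℤ) + o)))
          + k * (B + A * (k * k - 1ℤ)) + k * A * e)
      ≡ k * p * (+ 3 * A * ((+ 2 * n + (c + ((k - 1ℤ) + o))) * (+ 2 * n + (c + ((k - 1ℤ) + o))))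
          + B + A * ((k * k - 1ℤ) + e))
  expand = solve-∀

+-sum-pred : ∀ {ks} → All NonZero ks → + sum (map pred ks) ≡ offset ks
+-sum-pred []                      = refl
+-sum-pred {suc k ∷ ks} (nz ∷ nzs) = cong (λ z → + k + z) (+-sum-pred nzs)

-- The difference of p₄ and P₃

numerator : ℤ → ℤ → ℤ → ℤ
numerator R S N =
  + 2 * (N ^ 3 + + 6 * N ^ 2 * R)
    + N * (+ 21 * R ^ 2 + + 2 * R * S - + 2 * S ^ 2)

product-parts : ∀ r s → product (parts r s) ≡ Δ r s
product-parts r s = begin
  s ℕ.* ((r ℕ.∸ s) ℕ.* ((r ℕ.+ s) ℕ.* ((2 ℕ.* r ℕ.∸ s) ℕ.* 1)))
    ≡⟨ cong (λ z → s ℕ.* ((r ℕ.∸ s) ℕ.* ((r ℕ.+ s) ℕ.* z))) (ℕ.*-identityʳ _) ⟩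
  s ℕ.* ((r ℕ.∸ s) ℕ.* ((r ℕ.+ s) ℕ.* (2 ℕ.* r ℕ.∸ s)))
    ≡⟨ ℕ.*-assoc s (r ℕ.∸ s) _ ⟨
  s ℕ.* (r ℕ.∸ s) ℕ.* ((r ℕ.+ s) ℕ.* (2 ℕ.* r ℕ.∸ s))
    ≡⟨ ℕ.*-assoc (s ℕ.* (r ℕ.∸ s)) (r ℕ.+ s) _ ⟨
  Δ r s ∎

module _ {r s : ℕ} (1≤s : 1 ℕ.≤ s) (2s<r : 2 ℕ.* s ℕ.< r) where

  private
    R = + r
    S = + s
    ks = parts r s
    D = + product ks
    p = p₄ r s

    s<r : s ℕ.< r
    s<r = ℕ.≤-<-trans (ℕ.m≤m+n s (s ℕ.+ 0)) 2s<r

    s<2r : s ℕ.< 2 ℕ.* r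
    s<2r = ℕ.<-≤-trans s<r (ℕ.m≤m+n r (r ℕ.+ 0))

    parts-nonZero : All NonZero ks
    parts-nonZero = ℕ.>-nonZero 1≤s
      ∷ ℕ.>-nonZero (ℕ.m<n⇒0<n∸m s<r)
      ∷ ℕ.>-nonZero (ℕ.≤-trans 1≤s (ℕ.m≤n+m s r))
      ∷ ℕ.>-nonZero (ℕ.m<n⇒0<n∸m s<2r)
      ∷ []

    pos-∸ : ∀ {m n} → n ℕ.≤ m → + (m ℕ.∸ n) ≡ + m - + n
    pos-∸ {m} {n} n≤m = sym (trans (ℤ.m-n≡m⊖n m n) (ℤ.⊖-≥ n≤m))

    pos-r∸s : + (r ℕ.∸ s) ≡ R - S
    pos-r∸s = pos-∸ (ℕ.<⇒≤ s<r)

    pos-2r∸s : + (2 ℕ.* r ℕ.∸ s) ≡ + 2 * R - S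
    pos-2r∸s = trans (pos-∸ (ℕ.<⇒≤ s<2r)) (cong (_- S) (ℤ.pos-* 2 r))

    offset-parts : offset ks ≡ + 4 * R - + 4
    offset-parts = trans
      (cong₂ (λ b d → (S - 1ℤ) + ((b - 1ℤ) + ((R + S - 1ℤ) + ((d - 1ℤ) + 0ℤ))))
             pos-r∸s pos-2r∸s)
      (collect R S)
      where
      collect : ∀ R S →
        (S - 1ℤ) + ((R - S - 1ℤ) + ((R + S - 1ℤ) + ((+ 2 * R - S - 1ℤ) + 0ℤ)))
          ≡ + 4 * R - + 4
      collect = solve-∀

    -- The sum of the squares of the parts.
    σ₂ = + 6 * R * R + + 4 * S * S - + 4 * R * S

    excess-parts : excess ks ≡ σ₂ - + 4
    excess-parts = trans
      (cong₂ (λ b d → (S * S - 1ℤ) + ((b * b - 1ℤ)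
                        + (((R + S) * (R + S) - 1ℤ) + ((d * d - 1ℤ) + 0ℤ))))
             pos-r∸s pos-2r∸s)
      (collect R S)
      where
      collect : ∀ R S →
        (S * S - 1ℤ) + (((R - S) * (R - S) - 1ℤ) + (((R + S) * (R + S) - 1ℤ)
            + (((+ 2 * R - S) * (+ 2 * R - S) - 1ℤ) + 0ℤ)))
          ≡ + 6 * R * R + + 4 * S * S - + 4 * R * S - + 4
      collect = solve-∀

    binomial : ℕ → ℤ
    binomial n = (+ 4 * R - + 2 + + n) * (+ 4 * R - 1ℤ + + n)

    windows-p : ∀ n → windows ks p n ≡ partialSums^ 4 1ˢ (n ℕ.+ sum (map pred ks))
    windows-p n =
      trans (windows≡partialSums-backdiffs parts-nonZero p n)
        (partialSums^-cong 4
          (λ i → trans (sym (*ˢ-denominator r s p i)) (p₄-correct 1≤s 2s<r i))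
          (n ℕ.+ sum (map pred ks)))

    windows-diff-p : ∀ n → + 2 * windows ks (diff p) n ≡ binomial n
    windows-diff-p n = begin
      + 2 * windows ks (diff p) n
        ≡⟨ cong (+ 2 *_) (trans (windows-diff ks p n)
             (cong₂ _-_ (windows-p (suc n)) (windows-p n))) ⟩
      + 2 * (partialSums^ 4 1ˢ m + partialSums^ 3 1ˢ (suc m) - partialSums^ 4 1ˢ m)
        ≡⟨ cong (+ 2 *_) (cancel (partialSums^ 4 1ˢ m) _) ⟩
      + 2 * partialSums^ 3 1ˢ (suc m)
        ≡⟨ triangular (suc m) ⟩
      (1ℤ + (1ℤ + + m)) * (+ 2 + (1ℤ + + m))
        ≡⟨ cong (λ M → (1ℤ + (1ℤ + M)) * (+ 2 + (1ℤ + M)))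
             (cong (λ o → + n + o) (trans (+-sum-pred parts-nonZero) offset-parts)) ⟩
      (1ℤ + (1ℤ + (+ n + (+ 4 * R - + 4)))) * (+ 2 + (1ℤ + (+ n + (+ 4 * R - + 4))))
        ≡⟨ collect R (+ n) ⟩
      binomial n ∎
      where
      m = n ℕ.+ sum (map pred ks)

      cancel : ∀ a b → a + b - a ≡ b
      cancel = solve-∀

      collect : ∀ R N →
        (1ℤ + (1ℤ + (N + (+ 4 * R - + 4)))) * (+ 2 + (1ℤ + (N + (+ 4 * R - + 4))))
          ≡ (+ 4 * R - + 2 + N) * (+ 4 * R - 1ℤ + N)
      collect = solve-∀

    -- The factor 4 makes the completed square of diff F integral.
    F : Series
    F n = + 4 * numerator R S (+ n)

    diff-F : diff F ≗ quadratic (+ 2) (+ 2 - + 2 * σ₂) (+ 4 * R + 1ℤ)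
    diff-F n = expand R S (+ n)
      where
      -- _^_ is unfolded because the ring solver does not interpret it.
      expand : ∀ R S N →
        + 4 * (+ 2 * ((1ℤ + N) * ((1ℤ + N) * ((1ℤ + N) * 1ℤ))
                        + + 6 * ((1ℤ + N) * ((1ℤ + N) * 1ℤ)) * R)
               + (1ℤ + N) * (+ 21 * (R * (R * 1ℤ)) + + 2 * R * S - + 2 * (S * (S * 1ℤ))))
          - + 4 * (+ 2 * (N * (N * (N * 1ℤ)) + + 6 * (N * (N * 1ℤ)) * R)
               + N * (+ 21 * (R * (R * 1ℤ)) + + 2 * R * S - + 2 * (S * (S * 1ℤ))))
        ≡ + 3 * + 2 * ((+ 2 * N + (+ 4 * R + 1ℤ)) * (+ 2 * N + (+ 4 * R + 1ℤ)))
            + (+ 2 - + 2 * (+ 6 * R * R + + 4 * S * S - + 4 * R * S))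
      expand = solve-∀

    windows-diff-F : ∀ n → windows ks (diff F) n ≡ + 24 * D * binomial n
    windows-diff-F n = begin
      windows ks (diff F) n
        ≡⟨ windows-cong ks diff-F n ⟩
      windows ks (quadratic (+ 2) (+ 2 - + 2 * σ₂) (+ 4 * R + 1ℤ)) n
        ≡⟨ windows-quadratic ks (+ 2) (+ 2 - + 2 * σ₂) (+ 4 * R + 1ℤ) n ⟩
      D * (quadratic (+ 2) (+ 2 - + 2 * σ₂) (+ 4 * R + 1ℤ + offset ks) n
             + + 2 * excess ks)
        ≡⟨ cong₂ (λ o e → D * (quadratic (+ 2) (+ 2 - + 2 * σ₂) (+ 4 * R + 1ℤ + o) n
                                 + + 2 * e))
             offset-parts excess-parts ⟩
      D * (quadratic (+ 2) (+ 2 - + 2 * σ₂) (+ 4 * R + 1ℤ + (+ 4 * R - + 4)) n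
             + + 2 * (σ₂ - + 4))
        ≡⟨ collect D R σ₂ (+ n) ⟩
      + 24 * D * binomial n ∎
      where
      collect : ∀ D R σ N →
        D * (+ 3 * + 2 * ((+ 2 * N + (+ 4 * R + 1ℤ + (+ 4 * R - + 4)))
                            * (+ 2 * N + (+ 4 * R + 1ℤ + (+ 4 * R - + 4))))
               + (+ 2 - + 2 * σ) + + 2 * (σ - + 4))
          ≡ + 24 * D * ((+ 4 * R - + 2 + N) * (+ 4 * R - 1ℤ + N))
      collect = solve-∀

    W : Series
    W n = + 48 * D * p n - F n

    windows-diff-W : ∀ n → windows ks (diff W) n ≡ 0ℤ
    windows-diff-W n = begin
      windows ks (diff W) n
        ≡⟨ windows-cong ks
             (λ i → regroup (+ 48 * D) (p (suc i)) (F (suc i)) (p i) (F i)) n ⟩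
      windows ks (λ i → + 48 * D * diff p i - diff F i) n
        ≡⟨ windows-linear ks (+ 48 * D) (diff p) (diff F) n ⟩
      + 48 * D * windows ks (diff p) n - windows ks (diff F) n
        ≡⟨ cong₂ _-_ (halve D (windows ks (diff p) n)) (windows-diff-F n) ⟩
      + 24 * D * (+ 2 * windows ks (diff p) n) - + 24 * D * binomial n
        ≡⟨ ℤ.i≡j⇒i-j≡0 (cong (+ 24 * D *_) (windows-diff-p n)) ⟩
      0ℤ ∎
      where
      regroup : ∀ c a b d e → (c * a - b) - (c * d - e) ≡ c * (a - d) - (b - e)
      regroup = solve-∀

      halve : ∀ D w → + 48 * D * w ≡ + 24 * D * (+ 2 * w)
      halve = solve-∀

    W-period : AllPairs Coprime ks → HasPeriod (product ks) W
    W-period coprime n = ℤ.i-j≡0⇒i≡j _ _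
      (trans (sym (window-telescope (product ks) W n))
             (windows-product parts-nonZero coprime windows-diff-W n))

  p₄-numerator-period : AllPairs Coprime (parts r s) →
    HasPeriod (Δ r s) (λ n → + 2 * + (6 ℕ.* Δ r s) * p₄ r s n - numerator (+ r) (+ s) (+ n))
  p₄-numerator-period coprime rewrite sym (product-parts r s) = λ n →
    ℤ.*-cancelˡ-≡ (+ 4) _ _
      (trans (scaled (product ks ℕ.+ n)) (trans (W-period coprime n) (sym (scaled n))))
    where
    scaled : ∀ n →
      + 4 * (+ 2 * + (6 ℕ.* product ks) * p n - numerator R S (+ n)) ≡ W n
    scaled n = trans
      (cong (λ d → + 4 * (+ 2 * d * p n - numerator R S (+ n))) (ℤ.pos-* 6 (product ks)))
      (expand D (p n) (numerator R S (+ n)))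
      where
      expand : ∀ D p f → + 4 * (+ 2 * (+ 6 * D) * p - f) ≡ + 48 * D * p - + 4 * f
      expand = solve-∀

-- Nothing normalises Q, so the constant C₄ can be taken to be 0.
proposition3p1 : Σ[ C₄ ∈ (ℕ → ℕ → ℚ) ]
    ((r s : ℕ) (1≤s : 1 ℕ.≤ s) (2s<r : 2 ℕ.* s ℕ.< r) →
    AllPairs Coprime (parts r s) →
    Σ[ Q ∈ (ℕ → ℚ) ]
    (Periodic (Δ r s) Q ×
    ((n : ℕ) → fromℤ (p₄ r s n) ≡ P₃ r s {{Δ≢0 1≤s 2s<r}} n ℚ.+ C₄ r s ℚ.+ Q n)))
proposition3p1 = (λ _ _ → 0ℚ) , λ r s 1≤s 2s<r coprime →
    decomposition r s 1≤s 2s<r coprime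
  where
  module _ (r s : ℕ) (1≤s : 1 ℕ.≤ s) (2s<r : 2 ℕ.* s ℕ.< r)
           (coprime : AllPairs Coprime (parts r s)) where

    instance
      Δ-nonZero : NonZero (Δ r s)
      Δ-nonZero = Δ≢0 1≤s 2s<r

      6Δ-nonZero : NonZero (6 ℕ.* Δ r s)
      6Δ-nonZero = ℕ.m*n≢0 6 (Δ r s)

      12Δ-nonZero : NonZero (2 ℕ.* (6 ℕ.* Δ r s))
      12Δ-nonZero = ℕ.m*n≢0 2 (6 ℕ.* Δ r s)

    Q : ℕ → ℚ
    Q n = fromℤ (p₄ r s n) ℚ.- P₃ r s n

    v : ℕ → ℤ
    v n = + 2 * + (6 ℕ.* Δ r s) * p₄ r s n - numerator (+ r) (+ s) (+ n)

    Q-fraction : ∀ n → Q n ≡ v n ℚ./ (2 ℕ.* (6 ℕ.* Δ r s))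
    Q-fraction n = fraction (p₄ r s n) ((+ n) ^ 3 + + 6 * (+ n) ^ 2 * + r)
      (+ n * (+ 21 * (+ r) ^ 2 + + 2 * + r * + s - + 2 * (+ s) ^ 2)) (6 ℕ.* Δ r s)

    Q-periodic : Periodic (Δ r s) Q
    Q-periodic n = begin
      Q (n ℕ.+ Δ r s)                               ≡⟨ cong Q (ℕ.+-comm n (Δ r s)) ⟩
      Q (Δ r s ℕ.+ n)                               ≡⟨ Q-fraction (Δ r s ℕ.+ n) ⟩
      v (Δ r s ℕ.+ n) ℚ./ (2 ℕ.* (6 ℕ.* Δ r s))
        ≡⟨ cong (ℚ._/ (2 ℕ.* (6 ℕ.* Δ r s))) (p₄-numerator-period 1≤s 2s<r coprime n) ⟩
      v n ℚ./ (2 ℕ.* (6 ℕ.* Δ r s))                 ≡⟨ Q-fraction n ⟨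
      Q n                                           ∎

    p₄-decomposition : ∀ n → fromℤ (p₄ r s n) ≡ P₃ r s n ℚ.+ 0ℚ ℚ.+ Q n
    p₄-decomposition n = sym (begin
      P₃ r s n ℚ.+ 0ℚ ℚ.+ Q n  ≡⟨ cong (ℚ._+ Q n) (ℚ.+-identityʳ (P₃ r s n)) ⟩
      P₃ r s n ℚ.+ Q n         ≡⟨ ℚ.+-comm (P₃ r s n) (Q n) ⟩
      fromℤ (p₄ r s n) ℚ.- P₃ r s n ℚ.+ P₃ r s n
        ≡⟨ ℚ.+-assoc (fromℤ (p₄ r s n)) (ℚ.- P₃ r s n) (P₃ r s n) ⟩
      fromℤ (p₄ r s n) ℚ.+ (ℚ.- P₃ r s n ℚ.+ P₃ r s n)
        ≡⟨ cong (fromℤ (p₄ r s n) ℚ.+_) (ℚ.+-inverseˡ (P₃ r s n)) ⟩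
      fromℤ (p₄ r s n) ℚ.+ 0ℚ  ≡⟨ ℚ.+-identityʳ _ ⟩
      fromℤ (p₄ r s n)         ∎)

    decomposition : Σ[ Q ∈ (ℕ → ℚ) ] (Periodic (Δ r s) Q ×
      ((n : ℕ) → fromℤ (p₄ r s n) ≡ P₃ r s n ℚ.+ 0ℚ ℚ.+ Q n))
    decomposition = Q , Q-periodic , p₄-decomposition
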